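{- Let $\mathbb{V}$ be a vector space of dimension $n\ge 1$ over the field of $q\ge 3$ elements, with basis $\{b_1,\dots,b_n\}$, and let $G(\mathbb{V})$ be its non-zero component graph. Then $fxd(G(\mathbb{V}))=|G(\mathbb{V})|-1$, where $|G(\mathbb{V})|$ denotes the number of vertices of $G(\mathbb{V})$.
   Context: The non-zero component graph $G(\mathbb{V})$ (with respect to the basis $\{b_1,\dots,b_n\}$) has as vertices the non-zero vectors of $\mathbb{V}$; two distinct vertices are adjacent iff some $b_j$ has non-zero coefficient in both of their expansions in the basis. For a graph $G$, a set $D\subseteq V(G)$ is a fixing set of $G$ if the only automorphism of $G$ that fixes every vertex of $D$ is the identity. The fixed number $fxd(G)$ is the minimum number $k$ such that every subset of $V(G)$ of cardinality $k$ is a fixing set of $G$. -}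

module Defs where

open import Algebra.Bundles using (CommutativeRing)
open import Algebra.Definitions using (Invertible)
open import Algebra.Module.Bundles using (Module)
import Algebra.Definitions.RawMonoid as RawMonoidDefinitions
open import Data.Fin.Base using (Fin)
open import Data.Nat.Base using (ℕ; _≤_)
open import Data.Product.Base using (Σ; Σ-syntax; ∃-syntax; _×_; _,_; proj₁)
open import Data.Vec.Functional using (Vector)
open import Function.Base using (_∘_)
open import Function.Bundles using (Inverse; _⇔_)
open import Level using (Level; _⊔_; suc)
open import Relation.Binary.Bundles using (Setoid)
open import Relation.Binary.Core using (Rel)
open import Relation.Binary.Definitions using (Symmetric; _Respects_; _Respects₂_)
import Relation.Binary.Construct.On as On
import Relation.Binary.PropositionalEquality.Properties as ≡
open import Relation.Nullary.Negation.Core using (¬_)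
open import Relation.Unary using (Pred)

private
  variable
    c ℓ p r ℓr m ℓm : Level

HasCardinality : Setoid c ℓ → ℕ → Set (c ⊔ ℓ)
HasCardinality S k = Inverse (≡.setoid (Fin k)) S

-- Elements that are not equal to zero are invertible.  For finite fields,
-- whose equality is decidable, this agrees with the apartness-based
-- HeytingField of the library.
record IsField (K : CommutativeRing r ℓr) : Set (r ⊔ ℓr) where
  open CommutativeRing K
  field
    1≉0     : ¬ 1# ≈ 0#
    inverse : ∀ x → ¬ x ≈ 0# → Invertible _≈_ 1# _*_ x

record Subset (S : Setoid c ℓ) p : Set (c ⊔ ℓ ⊔ suc p) where
  open Setoid S
  field
    member : Pred Carrier p
    resp   : member Respects _≈_

  -- Membership proofs are irrelevant for the equality, so cardinality counts
  -- elements of S.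
  asSetoid : Setoid (c ⊔ p) ℓ
  asSetoid = On.setoid {B = Σ Carrier member} S proj₁

record Graph c ℓ p : Set (suc (c ⊔ ℓ ⊔ p)) where
  field
    vertices : Setoid c ℓ
  open Setoid vertices public
    using () renaming (Carrier to Vertex; _≈_ to _≈ⱽ_)
  field
    Adj         : Rel Vertex p
    adj-resp    : Adj Respects₂ _≈ⱽ_
    adj-sym     : Symmetric Adj
    adj-irrefl  : ∀ {x y} → x ≈ⱽ y → ¬ Adj x y

module _ (G : Graph c ℓ p) where
  open Graph G

  record Automorphism : Set (c ⊔ ℓ ⊔ p) where
    field
      bijection : Inverse vertices vertices
    open Inverse bijection public using (to)
    field
      adj-iff : ∀ x y → Adj x y ⇔ Adj (to x) (to y)

  -- The level ℓ is large enough for every finite set of vertices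
  -- {f i ∣ i ∈ Fin k}, whose membership predicate is ∃ i. f i ≈ x.
  VertexSet : Set (c ⊔ suc ℓ)
  VertexSet = Subset vertices ℓ

  IsFixingSet : VertexSet → Set (c ⊔ ℓ ⊔ p)
  IsFixingSet D = (φ : Automorphism) → let open Automorphism φ in
    (∀ x → Subset.member D x → to x ≈ⱽ x) → ∀ x → to x ≈ⱽ x

  AllFixing : ℕ → Set (c ⊔ suc ℓ ⊔ p)
  AllFixing k = (D : VertexSet) →
    HasCardinality (Subset.asSetoid D) k → IsFixingSet D

  -- fxd(G) = k, where fxd(G) is the least k satisfying AllFixing.
  IsFixedNumber : ℕ → Set (c ⊔ suc ℓ ⊔ p)
  IsFixedNumber k = AllFixing k × (∀ j → AllFixing j → k ≤ j)

module _ {K : CommutativeRing r ℓr} (V : Module K m ℓm) where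
  open CommutativeRing K using (Carrier; _≈_; 0#)
  open Module V using (Carrierᴹ; _≈ᴹ_; 0ᴹ; _*ₗ_; ≈ᴹ-setoid; ≈ᴹ-sym; ≈ᴹ-trans;
    +ᴹ-rawMonoid)
  open RawMonoidDefinitions +ᴹ-rawMonoid using (sum)

  linearCombination : ∀ {n} → Vector Carrier n → Vector Carrierᴹ n → Carrierᴹ
  linearCombination a b = sum (λ i → a i *ₗ b i)

  record IsBasis {n} (b : Vector Carrierᴹ n) : Set (r ⊔ ℓr ⊔ m ⊔ ℓm) where
    field
      spanning    : ∀ v → ∃[ a ] v ≈ᴹ linearCombination a b
      independent : ∀ a → linearCombination a b ≈ᴹ 0ᴹ → ∀ i → a i ≈ 0#

  NonZeroVector : Set (m ⊔ ℓm)
  NonZeroVector = Σ[ v ∈ Carrierᴹ ] ¬ v ≈ᴹ 0ᴹ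

  nonZeroVectors : Setoid (m ⊔ ℓm) ℓm
  nonZeroVectors = On.setoid {B = NonZeroVector} ≈ᴹ-setoid proj₁

  -- For a basis b the expansion of v exists and is unique up to _≈_, so the
  -- existential over a picks out the j-th coefficient of v.
  NonZeroCoefficient : ∀ {n} → Vector Carrierᴹ n → Carrierᴹ → Fin n →
                       Set (r ⊔ ℓr ⊔ ℓm)
  NonZeroCoefficient b v j =
    ∃[ a ] v ≈ᴹ linearCombination a b × ¬ a j ≈ 0#

  nonZeroComponentGraph : ∀ {n} (b : Vector Carrierᴹ n) → IsBasis b →
                          Graph (m ⊔ ℓm) ℓm (r ⊔ ℓr ⊔ ℓm)
  nonZeroComponentGraph b _ = record
    { vertices   = nonZeroVectors
    ; Adj        = λ (u , _) (v , _) → ¬ u ≈ᴹ v ×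
                     ∃[ j ] NonZeroCoefficient b u j × NonZeroCoefficient b v j
    ; adj-resp   =
        (λ v≈w (u≉v , j , cu , cv) →
          (λ u≈w → u≉v (≈ᴹ-trans u≈w (≈ᴹ-sym v≈w))) , j , cu , transport v≈w cv)
      , (λ u≈w (u≉v , j , cu , cv) →
          (λ w≈v → u≉v (≈ᴹ-trans u≈w w≈v)) , j , transport u≈w cu , cv)
    ; adj-sym    = λ (u≉v , j , cu , cv) → u≉v ∘ ≈ᴹ-sym , j , cv , cu
    ; adj-irrefl = λ u≈v (u≉v , _) → u≉v u≈v
    }
    where
    transport : ∀ {u v j} → u ≈ᴹ v →
                NonZeroCoefficient b u j → NonZeroCoefficient b v j
    transport u≈v (a , u≈ , aj≉0) = a , ≈ᴹ-trans (≈ᴹ-sym u≈v) u≈ , aj≉0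

{-# OPTIONS --safe #-}

-- If all vertices but one are fixed by an automorphism, so is the last one;
-- hence every set of |G| ∸ 1 vertices is fixing.  Conversely, q ≥ 3 provides a
-- scalar c other than 0 and 1, and the distinct vectors u and c u have the same
-- support, so exchanging them is a non-trivial automorphism which fixes every
-- set of vertices avoiding both.
module Submission where

open import Defs
open import Algebra.Bundles using (CommutativeRing)
open import Algebra.Module.Bundles using (Module)
import Algebra.Properties.CommutativeMonoid.Sum as Sum
import Algebra.Properties.Group as GroupProperties
open import Data.Fin.Base
  using (Fin; zero; suc; punchIn; punchOut; inject≤; fromℕ<; finToFun; funToFin;
         combine)
open import Data.Fin.Properties
  using (_≟_; punchIn-injective; punchInᵢ≢i; punchIn-punchOut; inject≤-injective;
         injective⇒≤; funToFin-finToFin; finToFun-funToFin)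
open import Data.Nat.Base using (ℕ; zero; suc; s≤s; _≤_; _<_; _∸_; _^_)
open import Data.Nat.Properties
  using (1+n≰n; ≮⇒≥; <⇒≤pred; <-≤-trans; m∸n≤m)
open import Data.Product.Base
  using (∃; ∃-syntax; _×_; _,_; proj₁; proj₂; map₂)
open import Data.Vec.Functional using (Vector)
open import Function.Base using (_∘_; _$_)
open import Function.Bundles
  using (Inverse; Injection; Bijection; _⇔_; mk⇔; Equivalence)
open import Function.Properties.Bijection using (Bijection⇒Inverse)
open import Function.Properties.Inverse using (Inverse⇒Injection)
import Function.Construct.Composition as Composition
import Function.Construct.Symmetry as Symmetry
open import Level using (Level; _⊔_)
open import Relation.Binary.Bundles using (Setoid)
open import Relation.Binary.Definitions using (Decidable)
import Relation.Binary.Reasoning.Setoid as SetoidReasoning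
open import Relation.Binary.PropositionalEquality as ≡
  using (_≡_; _≗_)
open import Relation.Nullary using (¬_; yes; no; contradiction)
open import Relation.Nullary.Decidable using (via-injection; decidable-stable)

private
  variable
    c ℓ c′ ℓ′ p r ℓr m ℓm : Level

-- Finite setoids

module _ {S : Setoid c ℓ} where
  open Setoid S

  enumeration⇒cardinality : ∀ {k} (f : Fin k → Carrier) →
    (∀ {i j} → f i ≈ f j → i ≡ j) → (∀ x → ∃[ i ] f i ≈ x) →
    HasCardinality S k
  enumeration⇒cardinality f f-injective f-surjective = Bijection⇒Inverse record
    { to        = f
    ; cong      = reflexive ∘ ≡.cong f
    ; bijective = f-injective
                , λ x → map₂ (λ fi≈x → λ { ≡.refl → fi≈x }) (f-surjective x)
    }

  cardinality⇒dec : ∀ {k} → HasCardinality S k → Decidable _≈_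
  cardinality⇒dec S↔k =
    via-injection (Inverse⇒Injection (Symmetry.inverse S↔k)) _≟_

  range : ∀ {k} → (Fin k → Carrier) → Subset S ℓ
  range f = record
    { member = λ x → ∃[ i ] f i ≈ x
    ; resp   = λ x≈y → map₂ (λ fi≈x → trans fi≈x x≈y)
    }

range-cardinality : ∀ {S : Setoid c ℓ} (let module S = Setoid S) {k}
  (f : Fin k → S.Carrier) → (∀ {i j} → f i S.≈ f j → i ≡ j) →
  HasCardinality (Subset.asSetoid (range {S = S} f)) k
range-cardinality {S = S} f f-injective = enumeration⇒cardinality
  (λ i → f i , i , Setoid.refl S) f-injective proj₂

cardinality-≤ : ∀ {S : Setoid c ℓ} {T : Setoid c′ ℓ′} {j k} →
  HasCardinality S j → HasCardinality T k → Injection S T → j ≤ k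
cardinality-≤ S↔j T↔k S↣T = injective⇒≤ (Injection.injective
  (Composition.injection (Inverse⇒Injection S↔j)
    (Composition.injection S↣T (Inverse⇒Injection (Symmetry.inverse T↔k)))))

infixl 6 _∖_

-- Being a setoid again, the complement can be punctured a second time; a second point carries the
-- proof that it differs from the first.
_∖_ : (S : Setoid c ℓ) → Setoid.Carrier S → Setoid (c ⊔ ℓ) ℓ
S ∖ x = Subset.asSetoid {S = S} record
  { member = λ y → ¬ y ≈ x
  ; resp   = λ y≈z y≉x z≈x → y≉x (trans y≈z z≈x)
  }
  where open Setoid S

-- The enumeration of `S` is followed while `punchIn` skips the index of `x`. As `x` rules out
-- `k = 0`, the truncated `k ∸ 1` is a true predecessor.
∖-cardinality : ∀ (S : Setoid c ℓ) x {k} → HasCardinality S k →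
                HasCardinality (S ∖ x) (k ∸ 1)
∖-cardinality S x {zero}  S↔k with () ← Inverse.from S↔k x
∖-cardinality S x {suc k} S↔k = enumeration⇒cardinality
  (λ i → to (punchIn (from x) i) , λ fi≈x →
    punchInᵢ≢i (from x) i (≡.sym (inverseʳ-≡ (sym fi≈x))))
  (λ eq → punchIn-injective (from x) _ _ (to-injective eq))
  (λ (y , y≉x) →
    let x≢y = λ eq → y≉x (sym (from-injective eq)) in
    punchOut x≢y ,
    trans (reflexive (≡.cong to (punchIn-punchOut x≢y))) (strictlyInverseˡ y))
  where
  open Setoid S
  open Inverse S↔k
  to-injective = Injection.injective (Inverse⇒Injection S↔k)
  from-injective = Injection.injective (Inverse⇒Injection (Symmetry.inverse S↔k))
  inverseʳ-≡ : ∀ {i y} → y ≈ to i → from y ≡ i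
  inverseʳ-≡ = inverseʳ

-- The inhabitant excludes `n = 0`, where truncation would make the inequality true.
Fin⇒n≰n∸1 : ∀ {n} → Fin n → ¬ n ≤ n ∸ 1
Fin⇒n≰n∸1 {suc n} _ = 1+n≰n

-- The transposition of two points

module Transposition {S : Setoid c ℓ} (_≈?_ : Decidable (Setoid._≈_ S))
                     (u v : Setoid.Carrier S) where
  open Setoid S

  -- The transposition as a relation, visibly symmetric in `x` and `y`. Proofs match on its three
  -- cases instead of unfolding decisions.
  data Swaps (x y : Carrier) : Set ℓ where
    there : x ≈ u → y ≈ v → Swaps x y
    back  : x ≈ v → y ≈ u → Swaps x y
    fixed : ¬ x ≈ u → ¬ x ≈ v → x ≈ y → Swaps x y

  swaps-total : ∀ x → ∃ (Swaps x)
  swaps-total x with x ≈? u | x ≈? v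
  ... | yes x≈u | _       = v , there x≈u refl
  ... | no  x≉u | yes x≈v = u , back x≈v refl
  ... | no  x≉u | no  x≉v = x , fixed x≉u x≉v refl

  swaps-sym : ∀ {x y} → Swaps x y → Swaps y x
  swaps-sym (there x≈u y≈v)     = back y≈v x≈u
  swaps-sym (back x≈v y≈u)      = there y≈u x≈v
  swaps-sym (fixed x≉u x≉v x≈y) =
    fixed (x≉u ∘ trans x≈y) (x≉v ∘ trans x≈y) (sym x≈y)

  swaps-functional : ∀ {x x′ y y′} → Swaps x y → Swaps x′ y′ → x ≈ x′ → y ≈ y′
  swaps-functional (there _ y≈v) (there _ y′≈v) _ = trans y≈v (sym y′≈v)
  -- One argument is both `u` and `v`, so the two points coincide and the chain passes through
  -- `v ≈ u`.
  swaps-functional (there x≈u y≈v) (back x′≈v y′≈u) x≈x′ =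
    trans y≈v (trans (sym x′≈v) (trans (sym x≈x′) (trans x≈u (sym y′≈u))))
  swaps-functional (back x≈v y≈u) (there x′≈u y′≈v) x≈x′ =
    trans y≈u (trans (sym x′≈u) (trans (sym x≈x′) (trans x≈v (sym y′≈v))))
  swaps-functional (back _ y≈u) (back _ y′≈u) _ = trans y≈u (sym y′≈u)
  swaps-functional (fixed _ _ x≈y) (fixed _ _ x′≈y′) x≈x′ =
    trans (sym x≈y) (trans x≈x′ x′≈y′)
  swaps-functional (there x≈u _) (fixed x′≉u _ _) x≈x′ =
    contradiction (trans (sym x≈x′) x≈u) x′≉u
  swaps-functional (back x≈v _) (fixed _ x′≉v _) x≈x′ =
    contradiction (trans (sym x≈x′) x≈v) x′≉v
  swaps-functional (fixed x≉u _ _) (there x′≈u _) x≈x′ =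
    contradiction (trans x≈x′ x′≈u) x≉u
  swaps-functional (fixed _ x≉v _) (back x′≈v _) x≈x′ =
    contradiction (trans x≈x′ x′≈v) x≉v

  swap : Carrier → Carrier
  swap x = proj₁ (swaps-total x)

  swap-swaps : ∀ x → Swaps x (swap x)
  swap-swaps x = proj₂ (swaps-total x)

  swap-cong : ∀ {x y} → x ≈ y → swap x ≈ swap y
  swap-cong = swaps-functional (swap-swaps _) (swap-swaps _)

  -- By symmetry of `Swaps`, `x` is also a value at `swap x`, and values are unique.
  swap-involutive : ∀ x → swap (swap x) ≈ x
  swap-involutive x =
    swaps-functional (swap-swaps (swap x)) (swaps-sym (swap-swaps x)) refl

  swap-inverse : Inverse S S
  swap-inverse = record
    { to        = swap
    ; from      = swap
    ; to-cong   = swap-cong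
    ; from-cong = swap-cong
    ; inverse   = swap-adjoint , swap-adjoint
    }
    where
    swap-adjoint : ∀ {x y} → y ≈ swap x → swap y ≈ x
    swap-adjoint {x} y≈ = trans (swap-cong y≈) (swap-involutive x)

  swap-u : swap u ≈ v
  swap-u = swaps-functional (swap-swaps u) (there refl refl) refl

  swap-fixed : ∀ {x} → ¬ x ≈ u → ¬ x ≈ v → swap x ≈ x
  swap-fixed x≉u x≉v =
    swaps-functional (swap-swaps _) (fixed x≉u x≉v refl) refl

-- Fixing sets of finite graphs

module _ (G : Graph c ℓ p) where
  open Graph G
  open Setoid vertices using ()
    renaming (refl to ≈-refl; sym to ≈-sym; trans to ≈-trans)

  -- Whether `u` and `v` are adjacent to each other is left open: exchanging them preserves that
  -- edge by symmetry.
  Twins : Vertex → Vertex → Set _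
  Twins u v = ∀ w → ¬ w ≈ⱽ u → ¬ w ≈ⱽ v → Adj u w ⇔ Adj v w

  adj-cong : ∀ {x x′ y y′} → x ≈ⱽ x′ → y ≈ⱽ y′ → Adj x y → Adj x′ y′
  adj-cong x≈x′ y≈y′ = proj₂ adj-resp x≈x′ ∘ proj₁ adj-resp y≈y′

  module _ (_≈?_ : Decidable _≈ⱽ_) {u v} (twins : Twins u v) where
    open Transposition {S = vertices} _≈?_ u v

    -- Stated for the symmetric relation, one implication yields both directions of `adj-iff`. The
    -- twin property handles exactly one moved endpoint.
    swaps-adj : ∀ {x x′ y y′} → Swaps x x′ → Swaps y y′ → Adj x y → Adj x′ y′
    swaps-adj (there x≈u _) (there y≈u _) xy =
      contradiction xy (adj-irrefl (≈-trans x≈u (≈-sym y≈u)))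
    swaps-adj (back x≈v _) (back y≈v _) xy =
      contradiction xy (adj-irrefl (≈-trans x≈v (≈-sym y≈v)))
    swaps-adj (there x≈u x′≈v) (back y≈v y′≈u) xy =
      adj-cong (≈-sym x′≈v) (≈-sym y′≈u) (adj-sym (adj-cong x≈u y≈v xy))
    swaps-adj (back x≈v x′≈u) (there y≈u y′≈v) xy =
      adj-cong (≈-sym x′≈u) (≈-sym y′≈v) (adj-sym (adj-cong x≈v y≈u xy))
    swaps-adj {y = y} (there x≈u x′≈v) (fixed y≉u y≉v y≈y′) xy =
      adj-cong (≈-sym x′≈v) y≈y′
        (Equivalence.to (twins y y≉u y≉v) (adj-cong x≈u ≈-refl xy))
    swaps-adj {y = y} (back x≈v x′≈u) (fixed y≉u y≉v y≈y′) xy =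
      adj-cong (≈-sym x′≈u) y≈y′
        (Equivalence.from (twins y y≉u y≉v) (adj-cong x≈v ≈-refl xy))
    swaps-adj {x = x} (fixed x≉u x≉v x≈x′) (there y≈u y′≈v) xy =
      adj-sym $ adj-cong (≈-sym y′≈v) x≈x′
        (Equivalence.to (twins x x≉u x≉v) (adj-cong y≈u ≈-refl (adj-sym xy)))
    swaps-adj {x = x} (fixed x≉u x≉v x≈x′) (back y≈v y′≈u) xy =
      adj-sym $ adj-cong (≈-sym y′≈u) x≈x′
        (Equivalence.from (twins x x≉u x≉v) (adj-cong y≈v ≈-refl (adj-sym xy)))
    swaps-adj (fixed _ _ x≈x′) (fixed _ _ y≈y′) = adj-cong x≈x′ y≈y′

    swapTwins : Automorphism G
    swapTwins = record
      { bijection = swap-inverse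
      ; adj-iff   = λ x y → mk⇔
          (swaps-adj (swap-swaps x) (swap-swaps y))
          (swaps-adj (swaps-sym (swap-swaps x)) (swaps-sym (swap-swaps y)))
      }

  module _ {N} (G↔N : HasCardinality vertices N) where

    -- If `φ` moved `x`, both `x` and its image would lie outside `D`, so `N ∸ 1` vertices would fit
    -- into the `N ∸ 2` remaining ones.
    allFixing-N∸1 : AllFixing G (N ∸ 1)
    allFixing-N∸1 D D↔N∸1 φ fixes x = decidable-stable
      (cardinality⇒dec G↔N (to x) x) λ φx≉x →
      let
        φx : Setoid.Carrier (vertices ∖ x)
        φx = to x , φx≉x
        G∖x↔N∸1 = ∖-cardinality vertices x G↔N

        x∉D : ¬ member x
        x∉D = φx≉x ∘ fixes x

        φx∉D : ¬ member (to x)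
        -- Were the image fixed, `φ` would send `x` and its image to the same vertex.
        φx∉D = φx≉x ∘ to-injective ∘ fixes (to x)
      in
      -- The image of `x`, lying in `vertices ∖ x`, witnesses that `N ∸ 1` is positive.
      Fin⇒n≰n∸1 (Inverse.from G∖x↔N∸1 φx) $
      cardinality-≤ D↔N∸1 (∖-cardinality (vertices ∖ x) φx G∖x↔N∸1) record
        { to        = λ (y , y∈D) →
            (y , λ y≈x → x∉D (resp y≈x y∈D)) , λ y≈φx → φx∉D (resp y≈φx y∈D)
        ; cong      = λ eq → eq
        ; injective = λ eq → eq
        }
      where
      open Automorphism φ
      open Subset D
      to-injective = Injection.injective (Inverse⇒Injection bijection)

    -- There is room for `j` vertices avoiding `u` and `v`; the exchange of the twins fixes them all
    -- but sends `u` to `v`.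
    twins⇒¬allFixing : ∀ u v → ¬ v ≈ⱽ u → Twins u v →
                       ∀ {j} → j < N ∸ 1 → ¬ AllFixing G j
    twins⇒¬allFixing u v v≉u twins {j} j<N∸1 allFixing = v≉u $
      ≈-trans (≈-sym swap-u) $
      allFixing (range f) (range-cardinality f f-injective)
        (swapTwins (cardinality⇒dec G↔N) twins)
        (λ x (i , fi≈x) → swap-fixed
          (f≉u i ∘ ≈-trans fi≈x) (f≉v i ∘ ≈-trans fi≈x))
        u
      where
      open Transposition {S = vertices} (cardinality⇒dec G↔N) u v

      rest : HasCardinality (vertices ∖ u ∖ (v , v≉u)) (N ∸ 1 ∸ 1)
      rest = ∖-cardinality (vertices ∖ u) (v , v≉u) (∖-cardinality vertices u G↔N)

      j≤N∸2 : j ≤ N ∸ 1 ∸ 1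
      j≤N∸2 = <⇒≤pred j<N∸1

      g : Fin j → Setoid.Carrier (vertices ∖ u ∖ (v , v≉u))
      -- The first `j` vertices in the enumeration of those other than `u` and `v`.
      g i = Inverse.to rest (inject≤ i j≤N∸2)

      f : Fin j → Vertex
      f = proj₁ ∘ proj₁ ∘ g

      f≉u : ∀ i → ¬ f i ≈ⱽ u
      f≉u = proj₂ ∘ proj₁ ∘ g

      f≉v : ∀ i → ¬ f i ≈ⱽ v
      f≉v = proj₂ ∘ g

      f-injective : ∀ {i k} → f i ≈ⱽ f k → i ≡ k
      f-injective eq = inject≤-injective j≤N∸2 j≤N∸2 _ _
        (Injection.injective (Inverse⇒Injection rest) eq)

-- Finite vector spaces

funToFin-cong : ∀ {m n} {f g : Fin m → Fin n} → f ≗ g → funToFin f ≡ funToFin g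
funToFin-cong {zero}  f≗g = ≡.refl
funToFin-cong {suc m} f≗g =
  ≡.cong₂ combine (f≗g zero) (funToFin-cong (f≗g ∘ suc))

module _ {K : CommutativeRing r ℓr} (V : Module K m ℓm) where
  open CommutativeRing K hiding (zero)
  open Module V
  open Sum +ᴹ-commutativeMonoid using (sum-cong-≋; ∑-distrib-+)
  open GroupProperties +-group using (//-rightDividesˡ; x∙y⁻¹≈ε⇒x≈y)
  open GroupProperties +ᴹ-group using (identityˡ-unique)
  open SetoidReasoning ≈ᴹ-setoid

  linearCombination-cong : ∀ {n} {a a′ : Vector Carrier n} b →
    (∀ i → a i ≈ a′ i) → linearCombination V a b ≈ᴹ linearCombination V a′ b
  linearCombination-cong b a≈a′ = sum-cong-≋ λ i → *ₗ-congʳ (a≈a′ i)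

  linearCombination-+ : ∀ {n} (a a′ : Vector Carrier n) b →
    linearCombination V (λ i → a i + a′ i) b ≈ᴹ
    linearCombination V a b +ᴹ linearCombination V a′ b
  linearCombination-+ a a′ b = begin
    linearCombination V (λ i → a i + a′ i) b
      ≈⟨ sum-cong-≋ (λ i → *ₗ-distribʳ (b i) (a i) (a′ i)) ⟩
    _ ≈⟨ ∑-distrib-+ (λ i → a i *ₗ b i) (λ i → a′ i *ₗ b i) ⟩
    linearCombination V a b +ᴹ linearCombination V a′ b ∎

  linearCombination-* : ∀ {n} s (a : Vector Carrier n) b →
    linearCombination V (λ i → s * a i) b ≈ᴹ s *ₗ linearCombination V a b
  linearCombination-* {zero}  s a b = ≈ᴹ-sym (*ₗ-zeroʳ s)
  linearCombination-* {suc n} s a b = begin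
    (s * a zero) *ₗ b zero +ᴹ linearCombination V (λ i → s * a (suc i)) (b ∘ suc)
      ≈⟨ +ᴹ-cong (*ₗ-assoc s (a zero) (b zero))
                 (linearCombination-* s (a ∘ suc) (b ∘ suc)) ⟩
    s *ₗ (a zero *ₗ b zero) +ᴹ s *ₗ linearCombination V (a ∘ suc) (b ∘ suc)
      ≈⟨ *ₗ-distribˡ s _ _ ⟨
    s *ₗ linearCombination V a b ∎

  -- Adding the combination of `a - a′` to that of `a′` leaves the latter unchanged, so the former
  -- vanishes and independence applies.
  linearCombination-injective : ∀ {n} {b : Vector Carrierᴹ n} → IsBasis V b →
    ∀ a a′ → linearCombination V a b ≈ᴹ linearCombination V a′ b →
    ∀ i → a i ≈ a′ i
  linearCombination-injective {b = b} basis a a′ eq i =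
    x∙y⁻¹≈ε⇒x≈y _ _ (independent (λ i → a i - a′ i) (identityˡ-unique _ _ (begin
      linearCombination V (λ i → a i - a′ i) b +ᴹ linearCombination V a′ b
        ≈⟨ linearCombination-+ _ a′ b ⟨
      linearCombination V (λ i → a i - a′ i + a′ i) b
        ≈⟨ linearCombination-cong b (λ i → //-rightDividesˡ (a′ i) (a i)) ⟩
      linearCombination V a b
        ≈⟨ eq ⟩
      linearCombination V a′ b ∎)) i)
    where open IsBasis basis

  -- An index below `q ^ n` is read as `n` digits in base `q`, each naming a coefficient.
  -- Independence makes this injective, spanning surjective.
  basis⇒cardinality : ∀ {q n} {b : Vector Carrierᴹ n} → IsBasis V b →
    HasCardinality setoid q → HasCardinality ≈ᴹ-setoid (q ^ n)
  basis⇒cardinality {q} {n} {b} basis K↔q = enumeration⇒cardinality f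
    (λ {i} {j} fi≈fj → ≡.trans (≡.sym (funToFin-finToFin {n} i)) $
      ≡.trans (funToFin-cong λ k → Injection.injective (Inverse⇒Injection K↔q)
        (linearCombination-injective basis _ _ fi≈fj k))
      (funToFin-finToFin {n} j))
    λ v → let a , v≈ab = spanning v in
      funToFin (from ∘ a) ,
      ≈ᴹ-trans (linearCombination-cong b λ i →
          trans (to-cong (finToFun-funToFin (from ∘ a) i)) (strictlyInverseˡ (a i)))
        (≈ᴹ-sym v≈ab)
    where
    open IsBasis basis
    open Inverse K↔q
    f : Fin (q ^ n) → Carrierᴹ
    f i = linearCombination V (to ∘ finToFun i) b

  -- Scaling by a non-zero scalar

  inverse-*ₗ : ∀ {s t} → t * s ≈ 1# → ∀ v → t *ₗ (s *ₗ v) ≈ᴹ v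
  inverse-*ₗ {s} {t} ts≈1 v = begin
    t *ₗ (s *ₗ v) ≈⟨ *ₗ-assoc t s v ⟨
    (t * s) *ₗ v  ≈⟨ *ₗ-congʳ ts≈1 ⟩
    1# *ₗ v       ≈⟨ *ₗ-identityˡ v ⟩
    v             ∎

  *ₗ-nonZero : IsField K → ∀ {s v} → ¬ s ≈ 0# → ¬ v ≈ᴹ 0ᴹ → ¬ s *ₗ v ≈ᴹ 0ᴹ
  *ₗ-nonZero field′ {s} {v} s≉0 v≉0 sv≈0 =
    let t , ts≈1 , _ = IsField.inverse field′ s s≉0 in
    v≉0 (begin
      v             ≈⟨ inverse-*ₗ ts≈1 v ⟨
      t *ₗ (s *ₗ v) ≈⟨ *ₗ-congˡ sv≈0 ⟩
      t *ₗ 0ᴹ       ≈⟨ *ₗ-zeroʳ t ⟩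
      0ᴹ            ∎)

  -- A fixed `v` would satisfy `(s - 1#) *ₗ v ≈ᴹ 0ᴹ` with both factors non-zero.
  *ₗ-moves : IsField K → ∀ {s v} → ¬ s ≈ 1# → ¬ v ≈ᴹ 0ᴹ → ¬ s *ₗ v ≈ᴹ v
  *ₗ-moves field′ {s} {v} s≉1 v≉0 sv≈v =
    *ₗ-nonZero field′ (s≉1 ∘ x∙y⁻¹≈ε⇒x≈y s 1#) v≉0 $
    identityˡ-unique ((s - 1#) *ₗ v) v (begin
      (s - 1#) *ₗ v +ᴹ v       ≈⟨ +ᴹ-congˡ (*ₗ-identityˡ v) ⟨
      (s - 1#) *ₗ v +ᴹ 1# *ₗ v ≈⟨ *ₗ-distribʳ v (s - 1#) 1# ⟨
      (s - 1# + 1#) *ₗ v       ≈⟨ *ₗ-congʳ (//-rightDividesˡ 1# s) ⟩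
      s *ₗ v                   ≈⟨ sv≈v ⟩
      v                        ∎)

  nonZeroCoefficient-*ₗ : ∀ {n} {b : Vector Carrierᴹ n} {s t} → t * s ≈ 1# →
    ∀ {u v} → v ≈ᴹ s *ₗ u →
    ∀ {j} → NonZeroCoefficient V b u j → NonZeroCoefficient V b v j
  nonZeroCoefficient-*ₗ {b = b} {s} {t} ts≈1 {u} {v} v≈su {j} (a , u≈ab , aj≉0) =
    (λ i → s * a i) , (begin
      v                                     ≈⟨ v≈su ⟩
      s *ₗ u                                ≈⟨ *ₗ-congˡ u≈ab ⟩
      s *ₗ linearCombination V a b          ≈⟨ linearCombination-* s a b ⟨
      linearCombination V (λ i → s * a i) b ∎) ,
    -- Multiplying `s * a j ≈ 0#` by `t` would give `a j ≈ 0#`.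
    λ sa≈0 → aj≉0 (trans (sym (*-identityˡ _)) (trans (*-congʳ (sym ts≈1))
      (trans (*-assoc _ _ _) (trans (*-congˡ sa≈0) (zeroʳ t)))))

  -- Scaling by `s` and by its inverse both preserve the support, so `v` and `s *ₗ v` share the same
  -- index `j` with `w`. Distinctness, the other half of adjacency, comes from `w` avoiding both.
  scaled-twins : (field′ : IsField K) → ∀ {n} {b : Vector Carrierᴹ n} basis
    {s v} (s≉0 : ¬ s ≈ 0#) (v≉0 : ¬ v ≈ᴹ 0ᴹ) →
    Twins (nonZeroComponentGraph V b basis)
      (v , v≉0) (s *ₗ v , *ₗ-nonZero field′ s≉0 v≉0)
  scaled-twins field′ basis {s} {v} s≉0 v≉0 w w≉v w≉sv =
    let t , ts≈1 , st≈1 = IsField.inverse field′ s s≉0 in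
    mk⇔
      (λ (_ , j , vj , wj) → w≉sv ∘ ≈ᴹ-sym , j ,
        nonZeroCoefficient-*ₗ ts≈1 ≈ᴹ-refl vj , wj)
      (λ (_ , j , svj , wj) → w≉v ∘ ≈ᴹ-sym , j ,
        nonZeroCoefficient-*ₗ st≈1 (≈ᴹ-sym (inverse-*ₗ ts≈1 v)) svj , wj)

-- The third scalar and the fixed number

module _ {K : CommutativeRing r ℓr} (field′ : IsField K) where
  open CommutativeRing K hiding (zero)

  scalar≉0,1 : ∀ {q} → HasCardinality setoid q → 3 ≤ q →
               ∃[ s ] ¬ s ≈ 0# × ¬ s ≈ 1#
  scalar≉0,1 K↔q (s≤s (s≤s (s≤s _))) =
    let (s , s≉0) , s≉1 = Inverse.to
          (∖-cardinality (setoid ∖ 0#) (1# , IsField.1≉0 field′)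
            (∖-cardinality setoid 0# K↔q))
          -- With `q` at least 3, an index survives the removal of `0#` and `1#`.
          zero
    in s , s≉0 , s≉1

theorem4p6 : ∀ {r ℓr m ℓm : Level} (K : CommutativeRing r ℓr) → IsField K →
    ∀ (q : ℕ) → HasCardinality (CommutativeRing.setoid K) q → 3 ≤ q →
    (V : Module K m ℓm) →
    ∀ (n : ℕ) → 1 ≤ n →
    (b : Vector (Module.Carrierᴹ V) n) (basis : IsBasis V b) →
    let G = nonZeroComponentGraph V b basis in
    ∃[ N ] HasCardinality (Graph.vertices G) N × IsFixedNumber G (N ∸ 1)
theorem4p6 K field′ q K↔q 3≤q V n _ b basis =
  N , G↔N , allFixing-N∸1 G G↔N , λ j allFixing → ≮⇒≥ λ j<N∸1 →
    let
      -- Any vertex serves; the one of index `j` exists because `j < N`.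
      v , v≉0 = Inverse.to G↔N (fromℕ< (<-≤-trans j<N∸1 (m∸n≤m N 1)))
      s , s≉0 , s≉1 = scalar≉0,1 field′ K↔q 3≤q
    in
    twins⇒¬allFixing G G↔N (v , v≉0) (s *ₗ v , *ₗ-nonZero V field′ s≉0 v≉0)
      (*ₗ-moves V field′ s≉1 v≉0) (scaled-twins V field′ basis s≉0 v≉0) j<N∸1 allFixing
  where
  open Module V using (_*ₗ_)
  G = nonZeroComponentGraph V b basis
  N = q ^ n ∸ 1
  G↔N : HasCardinality (Graph.vertices G) N
  G↔N = ∖-cardinality (Module.≈ᴹ-setoid V) (Module.0ᴹ V)
          (basis⇒cardinality V basis K↔q)
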